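{- An algebra $\mathbf B=\langle B,\land,\lor,\otimes,\oplus,\supset,\neg\rangle$ is an implicative bilattice if and only if $\mathbf B$ is isomorphic to the product bilattice $\mathbf L\odot\mathbf L$, for some classical implicative lattice $\mathbf L=\langle L,\sqcap,\sqcup,\backslash,1\rangle$, endowed with the operation $\supset$ defined by $\langle a_1,a_2\rangle\supset\langle b_1,b_2\rangle=\langle a_1\backslash b_1,\ a_1\sqcap b_2\rangle$ for all $a_1,a_2,b_1,b_2\in L$.
   Context: A bilattice is an algebra $\langle B,\land,\lor,\otimes,\oplus,\neg\rangle$ such that $\langle B,\land,\lor\rangle$ and $\langle B,\otimes,\oplus\rangle$ are lattices (not necessarily bounded) with orders $\leq_t$ and $\leq_k$, and $\neg$ is unary with: $a\leq_t b\Rightarrow\neg b\leq_t\neg a$; $a\leq_k b\Rightarrow\neg a\leq_k\neg b$; $\neg\neg a=a$. An implicative bilattice is an algebra $\langle B,\land,\lor,\otimes,\oplus,\supset,\neg\rangle$ whose $\supset$-free reduct is a bilattice and which satisfies: (IB1) $(x\supset x)\supset y\approx y$; (IB2) $x\supset(y\supset z)\approx(x\land y)\supset z\approx(x\otimes y)\supset z$; (IB3) $((x\supset y)\supset x)\supset x\approx x\supset x$; (IB4) $(x\lor y)\supset z\approx(x\supset z)\land(y\supset z)\approx(x\oplus y)\supset z$; (IB5) $x\land((x\supset y)\supset(x\otimes y))\approx x$; (IB6) $\neg(x\supset y)\supset z\approx(x\land\neg y)\supset z$. A classical implicative lattice is a relatively complemented distributive lattice $\langle L,\sqcap,\sqcup\rangle$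 with maximum $1$; for $a,b\in L$, $a\backslash b$ denotes the relative complement of $a$ in $[a\sqcap b,1]$, i.e. the unique element with $a\sqcap(a\backslash b)=a\sqcap b$ and $a\sqcup(a\backslash b)=1$. The product bilattice $\mathbf L\odot\mathbf L$ has universe $L\times L$ and operations $\langle a_1,a_2\rangle\land\langle b_1,b_2\rangle=\langle a_1\sqcap b_1,a_2\sqcup b_2\rangle$, $\langle a_1,a_2\rangle\lor\langle b_1,b_2\rangle=\langle a_1\sqcup b_1,a_2\sqcap b_2\rangle$, $\langle a_1,a_2\rangle\otimes\langle b_1,b_2\rangle=\langle a_1\sqcap b_1,a_2\sqcap b_2\rangle$, $\langle a_1,a_2\rangle\oplus\langle b_1,b_2\rangle=\langle a_1\sqcup b_1,a_2\sqcup b_2\rangle$, $\neg\langle a_1,a_2\rangle=\langle a_2,a_1\rangle$. -}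

module Defs where

open import Algebra.Core using (Op₁; Op₂)
open import Algebra.Definitions using (Congruent₁; Congruent₂)
import Algebra.Lattice.Structures as LatticeStructures
import Algebra.Morphism.Definitions as MorphismDefinitions
open import Data.Product using (∃; _×_; _,_; swap)
open import Data.Product.Relation.Binary.Pointwise.NonDependent
  using (Pointwise; ×-isEquivalence)
open import Level using (Level; suc) renaming (_⊔_ to _⊔ˡ_)
open import Relation.Binary.Bundles using (Setoid)
open import Relation.Binary.Core using (Rel; _Preserves_⟶_)
import Relation.Binary.Construct.NaturalOrder.Left as NaturalOrder
open import Relation.Binary.Definitions using (Maximum)
open import Relation.Binary.Morphism.Structures using (IsRelIsomorphism)
import Relation.Binary.Reasoning.Setoid as SetoidReasoning
open import Relation.Binary.Structures using (IsEquivalence)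

private
  variable
    a c ℓ : Level

-- Equality in an algebra is an equivalence relation respected by the
-- operations. Universes of algebras are non-empty by convention; the witness
-- `nonEmpty` is not part of the signature, and isomorphisms ignore it.
record BilatticeAlgebra c ℓ : Set (suc (c ⊔ˡ ℓ)) where
  infix  8 ¬_
  infixr 7 _∧_ _⊗_
  infixr 6 _∨_ _⊕_
  infixr 5 _⊃_
  infix  4 _≈_
  field
    Carrier       : Set c
    _≈_           : Rel Carrier ℓ
    _∧_ _∨_       : Op₂ Carrier
    _⊗_ _⊕_       : Op₂ Carrier
    _⊃_           : Op₂ Carrier
    ¬_            : Op₁ Carrier
    nonEmpty      : Carrier
    isEquivalence : IsEquivalence _≈_
    ∧-cong        : Congruent₂ _≈_ _∧_
    ∨-cong        : Congruent₂ _≈_ _∨_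
    ⊗-cong        : Congruent₂ _≈_ _⊗_
    ⊕-cong        : Congruent₂ _≈_ _⊕_
    ⊃-cong        : Congruent₂ _≈_ _⊃_
    ¬-cong        : Congruent₁ _≈_ ¬_

  setoid : Setoid c ℓ
  setoid = record { isEquivalence = isEquivalence }

module _ {A : Set a} (_≈_ : Rel A ℓ) where

  open LatticeStructures _≈_ using (IsLattice)

  record IsBilattice (∧ ∨ ⊗ ⊕ : Op₂ A) (¬ : Op₁ A) : Set (a ⊔ˡ ℓ) where
    open NaturalOrder _≈_ ∧ public using () renaming (_≤_ to _≤ₜ_)
    open NaturalOrder _≈_ ⊗ public using () renaming (_≤_ to _≤ₖ_)
    field
      ∧-∨-isLattice : IsLattice ∨ ∧
      ⊗-⊕-isLattice : IsLattice ⊕ ⊗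
      ¬-antitoneₜ   : ∀ {x y} → x ≤ₜ y → ¬ y ≤ₜ ¬ x
      ¬-monotoneₖ   : ¬ Preserves _≤ₖ_ ⟶ _≤ₖ_
      ¬-involutive  : ∀ x → ¬ (¬ x) ≈ x

record IsImplicativeBilattice (B : BilatticeAlgebra c ℓ) : Set (c ⊔ˡ ℓ) where
  open BilatticeAlgebra B
  field
    isBilattice : IsBilattice _≈_ _∧_ _∨_ _⊗_ _⊕_ ¬_
    IB1  : ∀ x y   → ((x ⊃ x) ⊃ y) ≈ y
    IB2ₜ : ∀ x y z → (x ⊃ (y ⊃ z)) ≈ ((x ∧ y) ⊃ z)
    IB2ₖ : ∀ x y z → ((x ∧ y) ⊃ z) ≈ ((x ⊗ y) ⊃ z)
    IB3  : ∀ x y   → (((x ⊃ y) ⊃ x) ⊃ x) ≈ (x ⊃ x)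
    IB4ₜ : ∀ x y z → ((x ∨ y) ⊃ z) ≈ ((x ⊃ z) ∧ (y ⊃ z))
    IB4ₖ : ∀ x y z → ((x ⊃ z) ∧ (y ⊃ z)) ≈ ((x ⊕ y) ⊃ z)
    IB5  : ∀ x y   → (x ∧ ((x ⊃ y) ⊃ (x ⊗ y))) ≈ x
    IB6  : ∀ x y z → ((¬ (x ⊃ y)) ⊃ z) ≈ ((x ∧ (¬ y)) ⊃ z)

module _ (A B : BilatticeAlgebra c ℓ) where
  private
    module A = BilatticeAlgebra A
    module B = BilatticeAlgebra B

  open MorphismDefinitions A.Carrier B.Carrier B._≈_
    using (Homomorphic₁; Homomorphic₂)

  record IsIsomorphism (f : A.Carrier → B.Carrier) : Set (c ⊔ˡ ℓ) where
    field
      isRelIsomorphism : IsRelIsomorphism A._≈_ B._≈_ f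
      ∧-homo           : Homomorphic₂ f A._∧_ B._∧_
      ∨-homo           : Homomorphic₂ f A._∨_ B._∨_
      ⊗-homo           : Homomorphic₂ f A._⊗_ B._⊗_
      ⊕-homo           : Homomorphic₂ f A._⊕_ B._⊕_
      ⊃-homo           : Homomorphic₂ f A._⊃_ B._⊃_
      ¬-homo           : Homomorphic₁ f A.¬_ B.¬_

infix 4 _≅_

_≅_ : Rel (BilatticeAlgebra c ℓ) (c ⊔ˡ ℓ)
A ≅ B = ∃ (IsIsomorphism A B)

-- y is a complement of x in the interval [ lo , hi ].
record IsRelativeComplement {A : Set a} (_≈_ : Rel A ℓ) (_⊓_ _⊔_ : Op₂ A)
                            (lo hi x y : A) : Set ℓ where
  field
    meet : (x ⊓ y) ≈ lo
    join : (x ⊔ y) ≈ hi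

record ClassicalImplicativeLattice c ℓ : Set (suc (c ⊔ˡ ℓ)) where
  infixr 7 _⊓_
  infixr 6 _⊔_
  infixr 5 _∖_
  infix  4 _≈_
  field
    Carrier : Set c
    _≈_     : Rel Carrier ℓ
    _⊓_     : Op₂ Carrier
    _⊔_     : Op₂ Carrier
    _∖_     : Op₂ Carrier
    𝟏       : Carrier

  open LatticeStructures _≈_ using (IsDistributiveLattice)
  open NaturalOrder _≈_ _⊓_ public using (_≤_)

  IsComplementIn : (lo hi x y : Carrier) → Set ℓ
  IsComplementIn = IsRelativeComplement _≈_ _⊓_ _⊔_

  field
    isDistributiveLattice  : IsDistributiveLattice _⊔_ _⊓_
    maximum                : Maximum _≤_ 𝟏
    relativelyComplemented : ∀ {lo hi x} → lo ≤ x → x ≤ hi →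
                             ∃ (IsComplementIn lo hi x)
    ∖-complement           : ∀ x y → IsComplementIn (x ⊓ y) 𝟏 x (x ∖ y)

  open IsDistributiveLattice isDistributiveLattice public

  setoid : Setoid c ℓ
  setoid = record { isEquivalence = isEquivalence }

  relativeComplement-unique : ∀ {lo hi x y z} →
    IsComplementIn lo hi x y → IsComplementIn lo hi x z → y ≈ z
  relativeComplement-unique {lo} {hi} {x} {y} {z} p q = begin
    y                    ≈⟨ ∧-absorbs-∨ y x ⟨
    y ⊓ (y ⊔ x)          ≈⟨ ∧-congˡ (∨-comm y x) ⟩
    y ⊓ (x ⊔ y)          ≈⟨ ∧-congˡ (trans P.join (sym Q.join)) ⟩
    y ⊓ (x ⊔ z)          ≈⟨ ∧-distribˡ-∨ y x z ⟩
    (y ⊓ x) ⊔ (y ⊓ z)    ≈⟨ ∨-congʳ (∧-comm y x) ⟩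
    (x ⊓ y) ⊔ (y ⊓ z)    ≈⟨ ∨-congʳ (trans P.meet (sym Q.meet)) ⟩
    (x ⊓ z) ⊔ (y ⊓ z)    ≈⟨ ∧-distribʳ-∨ z x y ⟨
    (x ⊔ y) ⊓ z          ≈⟨ ∧-congʳ (trans P.join (sym Q.join)) ⟩
    (x ⊔ z) ⊓ z          ≈⟨ ∧-comm (x ⊔ z) z ⟩
    z ⊓ (x ⊔ z)          ≈⟨ ∧-congˡ (∨-comm x z) ⟩
    z ⊓ (z ⊔ x)          ≈⟨ ∧-absorbs-∨ z x ⟩
    z                    ∎
    where
    open SetoidReasoning setoid
    module P = IsRelativeComplement p
    module Q = IsRelativeComplement q

  ∖-cong : Congruent₂ _≈_ _∖_
  ∖-cong {x} {x′} {y} {y′} x≈x′ y≈y′ =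
    relativeComplement-unique (∖-complement x y) (record
      { meet = trans (∧-congʳ x≈x′)
                 (trans (IsRelativeComplement.meet (∖-complement x′ y′))
                        (∧-cong (sym x≈x′) (sym y≈y′)))
      ; join = trans (∨-congʳ x≈x′)
                 (IsRelativeComplement.join (∖-complement x′ y′))
      })

-- The product bilattice L ⊙ L endowed with ⊃.
infix 9 _⊙²

_⊙² : ClassicalImplicativeLattice c ℓ → BilatticeAlgebra c ℓ
L ⊙² = record
  { Carrier       = L.Carrier × L.Carrier
  ; _≈_           = Pointwise L._≈_ L._≈_
  ; _∧_           = λ (a₁ , a₂) (b₁ , b₂) → (a₁ L.⊓ b₁ , a₂ L.⊔ b₂)
  ; _∨_           = λ (a₁ , a₂) (b₁ , b₂) → (a₁ L.⊔ b₁ , a₂ L.⊓ b₂)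
  ; _⊗_           = λ (a₁ , a₂) (b₁ , b₂) → (a₁ L.⊓ b₁ , a₂ L.⊓ b₂)
  ; _⊕_           = λ (a₁ , a₂) (b₁ , b₂) → (a₁ L.⊔ b₁ , a₂ L.⊔ b₂)
  ; _⊃_           = λ (a₁ , a₂) (b₁ , b₂) → (a₁ L.∖ b₁ , a₁ L.⊓ b₂)
  ; ¬_            = swap
  ; nonEmpty      = L.𝟏 , L.𝟏
  ; isEquivalence = ×-isEquivalence L.isEquivalence L.isEquivalence
  ; ∧-cong        = λ (p , q) (r , s) → L.∧-cong p r , L.∨-cong q s
  ; ∨-cong        = λ (p , q) (r , s) → L.∨-cong p r , L.∧-cong q s
  ; ⊗-cong        = λ (p , q) (r , s) → L.∧-cong p r , L.∧-cong q s
  ; ⊕-cong        = λ (p , q) (r , s) → L.∨-cong p r , L.∨-cong q s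
  ; ⊃-cong        = λ (p , q) (r , s) → L.∖-cong p r , L.∧-cong p s
  ; ¬-cong        = swap
  }
  where module L = ClassicalImplicativeLattice L

{-# OPTIONS --safe #-}

-- Call x designated when x ≈ x ⊃ x; the designated elements form a filter for
-- ≤ₜ. Entailment, x ⊢ y iff x ⊃ y is designated, is a preorder for
-- which ∧ and ⊗ are both meets, ∨ and ⊕ are both joins and ⊃ is a residual
-- satisfying Peirce's law, so B modulo mutual entailment is a classical
-- implicative lattice L. The isomorphism onto L ⊙ L is x ↦ ⟨ x , ¬ x ⟩. It is
-- injective because, by IB5, x ⊢ y holds exactly when x ≤ₜ x ⊗ y: if x, y and
-- ¬ x, ¬ y are pairwise equivalent, then both x and y equal x ⊗ y.

module Submission where

open import Defs
open import Level using (Level)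
open import Data.Product using (∃; _×_; _,_)
open import Function.Bundles using (_⇔_; mk⇔)
open import Algebra.Lattice.Bundles using (Lattice)
open import Algebra.Lattice.Morphism.Structures using (IsLatticeMonomorphism)
import Algebra.Lattice.Morphism.LatticeMonomorphism as LatticeMonomorphism
import Algebra.Lattice.Properties.Lattice as LatticeProperties
import Algebra.Lattice.Structures as LatticeStructures
open import Relation.Binary.Construct.Interior.Symmetric as Interior
  using (SymInterior; _,_)
import Relation.Binary.Lattice as Order
import Relation.Binary.Lattice.Properties.DistributiveLattice as DistributiveProperties
import Relation.Binary.Lattice.Properties.JoinSemilattice as JoinProperties
import Relation.Binary.Lattice.Properties.Lattice as OrderProperties
import Relation.Binary.Lattice.Properties.MeetSemilattice as MeetProperties
open import Relation.Binary.Morphism.Structures using (IsRelIsomorphism)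
import Relation.Binary.Reasoning.PartialOrder as PartialOrderReasoning
import Relation.Binary.Reasoning.Setoid as SetoidReasoning
open import Relation.Binary.Structures using (IsEquivalence)

private
  variable
    c ℓ : Level

-- De Morgan laws for negation in a bilattice.

module _ {a b ℓ₁ ℓ₂ ℓ₃ ℓ₄} (P : Order.MeetSemilattice a ℓ₁ ℓ₂)
         (Q : Order.MeetSemilattice b ℓ₃ ℓ₄) where
  private
    module P = Order.MeetSemilattice P
    module Q = Order.MeetSemilattice Q

  -- Right adjoints preserve meets. With `f` and `g` both negation, and `P` and `Q` ranging over the
  -- two orders and their duals, this yields all four De Morgan laws.
  rightAdjoint-∧-homo : {f : P.Carrier → Q.Carrier} {g : Q.Carrier → P.Carrier} →
    (∀ {p q} → g q P.≤ p → q Q.≤ f p) → (∀ {p q} → q Q.≤ f p → g q P.≤ p) →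
    ∀ x y → f (x P.∧ y) Q.≈ (f x Q.∧ f y)
  rightAdjoint-∧-homo to from x y = Q.antisym
    (Q.∧-greatest (to (P.trans (from Q.refl) (P.x∧y≤x x y)))
                  (to (P.trans (from Q.refl) (P.x∧y≤y x y))))
    (to (P.∧-greatest (from (Q.x∧y≤x _ _)) (from (Q.x∧y≤y _ _))))

IsBilatticeReduct : BilatticeAlgebra c ℓ → Set _
IsBilatticeReduct B = IsBilattice _≈_ _∧_ _∨_ _⊗_ _⊕_ ¬_
  where
  open BilatticeAlgebra B

module Bilattice (B : BilatticeAlgebra c ℓ) (isBilattice : IsBilatticeReduct B) where

  open BilatticeAlgebra B
  open IsBilattice isBilattice public

  truthLattice : Lattice c ℓ
  truthLattice = record { isLattice = ∧-∨-isLattice }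

  knowledgeLattice : Lattice c ℓ
  knowledgeLattice = record { isLattice = ⊗-⊕-isLattice }

  module ≤ₜ = Order.Lattice
    (LatticeProperties.∨-∧-orderTheoreticLattice truthLattice)
  module ≤ₖ = Order.Lattice
    (LatticeProperties.∨-∧-orderTheoreticLattice knowledgeLattice)

  private
    ≥ₜ-lattice = OrderProperties.∧-∨-lattice
      (LatticeProperties.∨-∧-orderTheoreticLattice truthLattice)
    ≥ₖ-lattice = OrderProperties.∧-∨-lattice
      (LatticeProperties.∨-∧-orderTheoreticLattice knowledgeLattice)
    module ≥ₜ = Order.Lattice ≥ₜ-lattice
    module ≥ₖ = Order.Lattice ≥ₖ-lattice

  ¬-swapₜˡ : ∀ {x y} → ¬ x ≤ₜ y → ¬ y ≤ₜ x
  ¬-swapₜˡ p = ≤ₜ.trans (¬-antitoneₜ p) (≤ₜ.reflexive (¬-involutive _))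

  ¬-swapₜʳ : ∀ {x y} → x ≤ₜ ¬ y → y ≤ₜ ¬ x
  ¬-swapₜʳ p = ≤ₜ.trans (≤ₜ.reflexive (≤ₜ.Eq.sym (¬-involutive _))) (¬-antitoneₜ p)

  ¬-transposeₖ : ∀ {x y} → ¬ x ≤ₖ y → x ≤ₖ ¬ y
  ¬-transposeₖ p = ≤ₖ.trans (≤ₖ.reflexive (≤ₖ.Eq.sym (¬-involutive _))) (¬-monotoneₖ p)

  ¬-transposeₖ⁻¹ : ∀ {x y} → x ≤ₖ ¬ y → ¬ x ≤ₖ y
  ¬-transposeₖ⁻¹ p = ≤ₖ.trans (¬-monotoneₖ p) (≤ₖ.reflexive (¬-involutive _))

  ¬-∧ : ∀ x y → ¬ (x ∧ y) ≈ ¬ x ∨ ¬ y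
  ¬-∧ = rightAdjoint-∧-homo ≤ₜ.meetSemilattice ≥ₜ.meetSemilattice ¬-swapₜˡ ¬-swapₜˡ

  ¬-∨ : ∀ x y → ¬ (x ∨ y) ≈ ¬ x ∧ ¬ y
  ¬-∨ = rightAdjoint-∧-homo ≥ₜ.meetSemilattice ≤ₜ.meetSemilattice ¬-swapₜʳ ¬-swapₜʳ

  ¬-⊗ : ∀ x y → ¬ (x ⊗ y) ≈ ¬ x ⊗ ¬ y
  ¬-⊗ = rightAdjoint-∧-homo ≤ₖ.meetSemilattice ≤ₖ.meetSemilattice
          ¬-transposeₖ ¬-transposeₖ⁻¹

  ¬-⊕ : ∀ x y → ¬ (x ⊕ y) ≈ ¬ x ⊕ ¬ y
  ¬-⊕ = rightAdjoint-∧-homo ≥ₖ.meetSemilattice ≥ₖ.meetSemilattice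
          ¬-transposeₖ⁻¹ ¬-transposeₖ

-- Designated elements and the entailment preorder.

module Entailment (B : BilatticeAlgebra c ℓ) (I : IsImplicativeBilattice B) where

  open BilatticeAlgebra B
  open IsImplicativeBilattice I
  open Bilattice B isBilattice public
  open IsEquivalence isEquivalence
  open SetoidReasoning setoid

  ⊃-congˡ : ∀ {x y z} → y ≈ z → (x ⊃ y) ≈ (x ⊃ z)
  ⊃-congˡ = ⊃-cong refl

  ⊃-congʳ : ∀ {x y z} → y ≈ z → (y ⊃ x) ≈ (z ⊃ x)
  ⊃-congʳ y≈z = ⊃-cong y≈z refl

  -- In `L ⊙²` these are the pairs whose first coordinate is `𝟏`.
  Designated : Carrier → Set ℓ
  Designated x = x ≈ x ⊃ x

  designated-resp : ∀ {x y} → x ≈ y → Designated x → Designated y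
  designated-resp x≈y d = trans (sym x≈y) (trans d (⊃-cong x≈y x≈y))

  ⊃-designated : ∀ x → Designated (x ⊃ x)
  ⊃-designated x = sym (IB1 x (x ⊃ x))

  designated-⊃ : ∀ {x} → Designated x → ∀ y → x ⊃ y ≈ y
  designated-⊃ d y = trans (⊃-congʳ d) (IB1 _ y)

  -- Two values of `x ⊃ y` are compared: it is `y` because `x` is designated, and it is `y ⊃ y`
  -- because `x` is `x ∧ y` and `IB2ₜ` unfolds `x ∧ y ⊃ y` to `x ⊃ (y ⊃ y)`.
  designated-upₜ : ∀ {x y} → x ≤ₜ y → Designated x → Designated y
  designated-upₜ {x} {y} x≤y d = begin
    y            ≈⟨ designated-⊃ d y ⟨
    x ⊃ y        ≈⟨ ⊃-congʳ x≤y ⟩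
    x ∧ y ⊃ y    ≈⟨ IB2ₜ x y y ⟨
    x ⊃ (y ⊃ y)  ≈⟨ designated-⊃ d _ ⟩
    y ⊃ y        ∎

  designated-∧ : ∀ {x y} → Designated x → Designated y → Designated (x ∧ y)
  designated-∧ {x} {y} dx dy = sym (begin
    x ∧ y ⊃ x ∧ y    ≈⟨ IB2ₜ x y _ ⟨
    x ⊃ (y ⊃ x ∧ y)  ≈⟨ designated-⊃ dx _ ⟩
    y ⊃ x ∧ y        ≈⟨ designated-⊃ dy _ ⟩
    x ∧ y            ∎)

  infix 4 _⊢_

  -- In `L ⊙²` this compares first coordinates only; second coordinates are reached through `¬`.
  _⊢_ : Carrier → Carrier → Set ℓ
  x ⊢ y = Designated (x ⊃ y)

  ⊢-refl : ∀ {x} → x ⊢ x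
  ⊢-refl = ⊃-designated _

  ⊢-mp : ∀ {x y} → Designated x → x ⊢ y → Designated y
  ⊢-mp d x⊢y = designated-resp (designated-⊃ d _) x⊢y

  ⊃-antitoneₜ : ∀ {x y} z → x ≤ₜ y → y ⊃ z ≤ₜ x ⊃ z
  ⊃-antitoneₜ {x} {y} z x≤y = ≤ₜ.trans
    (≤ₜ.reflexive (begin
      y ⊃ z              ≈⟨ ⊃-congʳ (JoinProperties.x≤y⇒x∨y≈y ≤ₜ.joinSemilattice x≤y) ⟨
      x ∨ y ⊃ z          ≈⟨ IB4ₜ x y z ⟩
      (x ⊃ z) ∧ (y ⊃ z)  ∎))
    (≤ₜ.x∧y≤x _ _)

  ≤ₜ⇒⊢ : ∀ {x y} → x ≤ₜ y → x ⊢ y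
  ≤ₜ⇒⊢ {x} {y} x≤y = designated-upₜ (⊃-antitoneₜ y x≤y) ⊢-refl

  ⊢-curry : ∀ {x y z} → x ∧ y ⊢ z → x ⊢ y ⊃ z
  ⊢-curry = designated-resp (sym (IB2ₜ _ _ _))

  ⊢-uncurry : ∀ {x y z} → x ⊢ y ⊃ z → x ∧ y ⊢ z
  ⊢-uncurry = designated-resp (IB2ₜ _ _ _)

  ⊢-weaken : ∀ {x y} → Designated y → x ⊢ y
  ⊢-weaken d = ⊢-mp d (⊢-curry (≤ₜ⇒⊢ (≤ₜ.x∧y≤x _ _)))

  -- As `x ⊃ y` is designated, the implication inside `IB5` collapses to `x ⊗ y`. This is the way
  -- back from entailment to an order of the bilattice.
  ⊢⇒≤ₜ⊗ : ∀ {x y} → x ⊢ y → x ≤ₜ x ⊗ y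
  ⊢⇒≤ₜ⊗ {x} {y} x⊢y = begin
    x                            ≈⟨ IB5 x y ⟨
    x ∧ ((x ⊃ y) ⊃ x ⊗ y)        ≈⟨ ∧-cong refl (designated-⊃ x⊢y _) ⟩
    x ∧ (x ⊗ y)                  ∎

  -- Antitonicity along `x ≤ₜ x ⊗ y` leaves `x ⊗ y ⊢ z`, which by `IB2ₜ` and `IB2ₖ` is `x ⊢ y ⊃ z`,
  -- a weakening of `y ⊢ z`.
  ⊢-trans : ∀ {x y z} → x ⊢ y → y ⊢ z → x ⊢ z
  ⊢-trans {x} {y} {z} x⊢y y⊢z = designated-upₜ (⊃-antitoneₜ z (⊢⇒≤ₜ⊗ x⊢y))
    (designated-resp (trans (IB2ₜ x y z) (IB2ₖ x y z)) (⊢-weaken y⊢z))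

  ≈⇒⊢ : ∀ {x y} → x ≈ y → x ⊢ y
  ≈⇒⊢ x≈y = designated-resp (⊃-congˡ x≈y) ⊢-refl

  -- The pairing `x ⊢ y ⊃ x ∧ y` is composed with `z ⊢ x` and then, after exchanging the conjuncts
  -- by currying, with `z ⊢ y`. The two resulting copies of `z` are merged through `z ≤ₜ z ∧ z`.
  ∧-greatest : ∀ {x y z} → z ⊢ x → z ⊢ y → z ⊢ x ∧ y
  ∧-greatest {x} {y} {z} z⊢x z⊢y =
    ⊢-trans (≤ₜ⇒⊢ (≤ₜ.∧-greatest ≤ₜ.refl ≤ₜ.refl)) (⊢-uncurry
      (⊢-trans z⊢y (⊢-curry (⊢-trans (≤ₜ⇒⊢ (≤ₜ.∧-greatest (≤ₜ.x∧y≤y y z) (≤ₜ.x∧y≤x y z)))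
        (⊢-uncurry (⊢-trans z⊢x (⊢-curry ⊢-refl)))))))

  ∨-least : ∀ {x y z} → x ⊢ z → y ⊢ z → x ∨ y ⊢ z
  ∨-least x⊢z y⊢z = designated-resp (sym (IB4ₜ _ _ _)) (designated-∧ x⊢z y⊢z)

  -- Mutual entailment and the quotient lattice.

  infix 4 _∼_

  _∼_ : Carrier → Carrier → Set ℓ
  _∼_ = SymInterior _⊢_

  ≈⇒∼ : ∀ {x y} → x ≈ y → x ∼ y
  ≈⇒∼ x≈y = ≈⇒⊢ x≈y , ≈⇒⊢ (sym x≈y)

  -- Taking `z` to be `y` and then `x` reduces both entailments to reflexivity. Axioms that equate
  -- two antecedents of an arbitrary `z` thereby become equivalences.
  ⊃-ext : ∀ {x y} → (∀ z → x ⊃ z ≈ y ⊃ z) → x ∼ y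
  ⊃-ext x⊃≈y⊃ = designated-resp (sym (x⊃≈y⊃ _)) ⊢-refl , designated-resp (x⊃≈y⊃ _) ⊢-refl

  ⊗∼∧ : ∀ {x y} → x ⊗ y ∼ x ∧ y
  ⊗∼∧ = ⊃-ext (λ z → sym (IB2ₖ _ _ z))

  ⊕∼∨ : ∀ {x y} → x ⊕ y ∼ x ∨ y
  ⊕∼∨ = ⊃-ext (λ z → sym (trans (IB4ₜ _ _ z) (IB4ₖ _ _ z)))

  -- This equivalence accounts for the second coordinate of `⊃` on pairs.
  ¬-⊃ : ∀ {x y} → ¬ (x ⊃ y) ∼ x ∧ ¬ y
  ¬-⊃ = ⊃-ext (IB6 _ _)

  ⊢-lattice : Order.Lattice c ℓ ℓ
  ⊢-lattice = record
    { isLattice = record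
      { isPartialOrder = Interior.isPartialOrder ⊢-refl ⊢-trans
      ; supremum = λ x y → ≤ₜ⇒⊢ (≤ₜ.x≤x∨y x y) , ≤ₜ⇒⊢ (≤ₜ.y≤x∨y x y) , λ _ → ∨-least
      ; infimum  = λ x y → ≤ₜ⇒⊢ (≤ₜ.x∧y≤x x y) , ≤ₜ⇒⊢ (≤ₜ.x∧y≤y x y) , λ _ → ∧-greatest
      }
    }

  module ⊢ = Order.Lattice ⊢-lattice
  module ∼ = IsEquivalence ⊢.isEquivalence
  open MeetProperties ⊢.meetSemilattice
    using (∧-monotonic; ∧-comm)

  ∧-comm-⊢ : ∀ {x y} → x ∧ y ⊢ y ∧ x
  ∧-comm-⊢ = ⊢.reflexive (∧-comm _ _)

  ⊃-eval : ∀ {x y} → x ∧ (x ⊃ y) ⊢ y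
  ⊃-eval = ⊢-trans ∧-comm-⊢ (⊢-uncurry ⊢-refl)

  ⊢-distributiveLattice : Order.DistributiveLattice c ℓ ℓ
  ⊢-distributiveLattice = record
    { isDistributiveLattice = record
      { isLattice    = ⊢.isLattice
      -- Meeting with `x` is left adjoint to `x ⊃_`, hence preserves joins: currying moves `x` to
      -- the right, where `∨-least` applies.
      ; ∧-distribˡ-∨ = λ x y z →
          ⊢-trans ∧-comm-⊢ (⊢-uncurry (∨-least
            (⊢-curry (⊢-trans ∧-comm-⊢ (⊢.x≤x∨y _ _)))
            (⊢-curry (⊢-trans ∧-comm-⊢ (⊢.y≤x∨y _ _)))))
          , ∨-least (∧-monotonic ⊢-refl (⊢.x≤x∨y _ _))
                    (∧-monotonic ⊢-refl (⊢.y≤x∨y _ _))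
      }
    }

  private
    module Distributive = DistributiveProperties ⊢-distributiveLattice

  peirce : ∀ x y → (x ⊃ y) ⊃ x ⊢ x
  peirce x y = designated-resp (sym (IB3 x y)) ⊢-refl

  -- Peirce's law for u = x ∨ (x ⊃ y): both u ⊃ y ⊢ x ⊃ y and x ⊃ y ⊢ u hold.
  excludedMiddle : ∀ x y → Designated (x ∨ (x ⊃ y))
  excludedMiddle x y = ⊢-mp
    (⊢-trans
      (⊢-curry (⊢-trans (∧-monotonic ⊢-refl (⊢.x≤x∨y _ _)) (⊢-uncurry ⊢-refl)))
      (⊢.y≤x∨y _ _))
    (peirce (x ∨ (x ⊃ y)) y)

  ∧-⊃ : ∀ x y → x ∧ (x ⊃ y) ∼ x ∧ y
  ∧-⊃ x y = ∧-greatest (⊢.x∧y≤x _ _) ⊃-eval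
          , ∧-monotonic ⊢-refl (⊢-curry (⊢.x∧y≤x _ _))

  -- The order of `quotient` is the natural order of `_∧_` up to `∼`; this implication and its
  -- converse identify it with `⊢`.
  ∼∧⇒⊢ : ∀ {x y} → x ∼ x ∧ y → x ⊢ y
  ∼∧⇒⊢ x∼x∧y = ⊢-trans (⊢.reflexive x∼x∧y) (⊢.x∧y≤y _ _)

  ⊢⇒∼∧ : ∀ {x y} → x ⊢ y → x ∼ x ∧ y
  ⊢⇒∼∧ x⊢y = ∧-greatest ⊢-refl x⊢y , ⊢.x∧y≤x _ _

  quotient : ClassicalImplicativeLattice c ℓ
  quotient = record
    { Carrier = Carrier
    ; _≈_ = _∼_
    ; _⊓_ = _∧_
    ; _⊔_ = _∨_
    ; _∖_ = _⊃_
    -- Every designated element is a top for `⊢`, and the witness of non-emptiness supplies one.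
    ; 𝟏   = nonEmpty ⊃ nonEmpty
    ; isDistributiveLattice = record
      { isLattice   = OrderProperties.isAlgLattice ⊢-lattice
      ; ∨-distrib-∧ = Distributive.∨-distrib-∧
      ; ∧-distrib-∨ = Distributive.∧-distrib-∨
      }
    ; maximum = λ _ → ⊢⇒∼∧ (⊢-weaken ⊢-refl)
    ; relativelyComplemented = λ {lo} {hi} {x} lo≤x x≤hi →
        let lo⊢x = ∼∧⇒⊢ lo≤x
            x⊢hi = ∼∧⇒⊢ x≤hi
        -- Since `lo` lies below `x`, the complement of `x` between `lo` and the top is `x ⊃ lo`;
        -- meeting it with `hi` cuts it down to the interval.
        in hi ∧ (x ⊃ lo) , record
          { meet = ⊢-trans (∧-monotonic ⊢-refl (⊢.x∧y≤y _ _)) ⊃-eval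
                 , ∧-greatest lo⊢x (∧-greatest (⊢-trans lo⊢x x⊢hi)
                                               (⊢-curry (⊢.x∧y≤x _ _)))
          ; join = ∨-least x⊢hi (⊢.x∧y≤x _ _)
                 , ⊢-trans (∧-greatest (⊢.y≤x∨y _ _) (⊢-weaken (excludedMiddle x lo)))
                           (⊢.reflexive (∼.sym (Distributive.∨-distribˡ-∧ _ _ _)))
          }
    ; ∖-complement = λ x y → record
        { meet = ∧-⊃ x y
        ; join = ⊢-weaken ⊢-refl , ⊢-weaken (excludedMiddle x y)
        }
    }

  -- The isomorphism with the product of the quotient.

  to : Carrier → Carrier × Carrier
  to x = x , ¬ x

  private
    -- The bound `¬ x ≤ₜ ¬ x ⊗ ¬ y` has right side `¬ (x ⊗ y)`, so negating it reverses the order.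
    -- Together with `⊢⇒≤ₜ⊗` it pins `x` to `x ⊗ y`.
    ¬-⊢-bound : ∀ {x y} → ¬ x ⊢ ¬ y → x ⊗ y ≤ₜ x
    ¬-⊢-bound {x} {y} ¬x⊢¬y = ≤ₜ.trans
      (¬-swapₜʳ (≤ₜ.trans (⊢⇒≤ₜ⊗ ¬x⊢¬y) (≤ₜ.reflexive (sym (¬-⊗ x y)))))
      (≤ₜ.reflexive (¬-involutive x))

  ⊗-comm : ∀ x y → x ⊗ y ≈ y ⊗ x
  ⊗-comm = LatticeStructures.IsLattice.∧-comm ⊗-⊕-isLattice

  to-injective : ∀ {x y} → x ∼ y → ¬ x ∼ ¬ y → x ≈ y
  to-injective (x⊢y , y⊢x) (¬x⊢¬y , ¬y⊢¬x) = begin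
    _      ≈⟨ ≤ₜ.antisym (⊢⇒≤ₜ⊗ x⊢y) (¬-⊢-bound ¬x⊢¬y) ⟩
    _ ⊗ _  ≈⟨ ⊗-comm _ _ ⟩
    _ ⊗ _  ≈⟨ ≤ₜ.antisym (⊢⇒≤ₜ⊗ y⊢x) (¬-⊢-bound ¬y⊢¬x) ⟨
    _      ∎

  -- In coordinates, half x y = ⟨ x₁ , x₂ ⊓ y₁ ⟩.
  half : Carrier → Carrier → Carrier
  half x y = x ∨ (x ⊗ ¬ y)

  half-∼ : ∀ x y → half x y ∼ x
  half-∼ x y = ∨-least ⊢-refl (⊢-trans (⊢.reflexive ⊗∼∧) (⊢.x∧y≤x _ _)) , ⊢.x≤x∨y _ _

  ¬-half-⊢ : ∀ x y → ¬ half x y ⊢ y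
  ¬-half-⊢ x y = ⊢-trans (≈⇒⊢ (¬-∨ _ _)) (⊢-trans (⊢.x∧y≤y _ _)
    (⊢-trans (≈⇒⊢ (¬-⊗ _ _)) (⊢-trans (⊢.reflexive ⊗∼∧)
      (⊢-trans (⊢.x∧y≤y _ _) (≈⇒⊢ (¬-involutive y))))))

  -- In coordinates this is `⟨ x₁ , y₁ ⟩`: the summands are `⟨ x₁ , x₂ ⊓ y₁ ⟩` and
  -- `⟨ y₂ ⊓ x₁ , y₁ ⟩`, and each unwanted entry is absorbed by the other summand.
  from : Carrier → Carrier → Carrier
  from x y = half x y ⊕ ¬ half y x

  from-∼ : ∀ x y → from x y ∼ x
  from-∼ x y = ⊢-trans (⊢.reflexive ⊕∼∨)
                 (∨-least (⊢.reflexive (half-∼ x y)) (¬-half-⊢ y x))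
             , ⊢-trans (⊢.reflexive (∼.sym (half-∼ x y)))
                 (⊢-trans (⊢.x≤x∨y _ _) (⊢.reflexive (∼.sym ⊕∼∨)))

  -- Negation distributes over `⊕` and exchanges the roles of the two halves, so the second
  -- coordinate of the preimage is handled by `from-∼ y x`.
  ¬-from : ∀ x y → ¬ from x y ≈ from y x
  ¬-from x y = begin
    ¬ (half x y ⊕ ¬ half y x)      ≈⟨ ¬-⊕ _ _ ⟩
    ¬ half x y ⊕ ¬ (¬ half y x)    ≈⟨ ⊕-cong refl (¬-involutive _) ⟩
    ¬ half x y ⊕ half y x          ≈⟨ LatticeStructures.IsLattice.∨-comm ⊗-⊕-isLattice _ _ ⟩
    half y x ⊕ ¬ half x y          ∎

  to-cong : ∀ {x y} → x ≈ y → (x ∼ y) × (¬ x ∼ ¬ y)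
  to-cong x≈y = ≈⇒∼ x≈y , ≈⇒∼ (¬-cong x≈y)

  to-isIsomorphism : IsIsomorphism B (quotient ⊙²) to
  to-isIsomorphism = record
    { isRelIsomorphism = record
      { isMonomorphism = record
        { isHomomorphism = record { cong = to-cong }
        ; injective      = λ (x∼y , ¬x∼¬y) → to-injective x∼y ¬x∼¬y
        }
      ; surjective = λ (x , y) → from x y , λ z≈from →
          let z∼from , ¬z∼¬from = to-cong z≈from
          in ∼.trans z∼from (from-∼ x y)
           , ∼.trans ¬z∼¬from (∼.trans (≈⇒∼ (¬-from x y)) (from-∼ y x))
      }
    ; ∧-homo = λ x y → ∼.refl , ≈⇒∼ (¬-∧ x y)
    ; ∨-homo = λ x y → ∼.refl , ≈⇒∼ (¬-∨ x y)
    ; ⊗-homo = λ x y → ⊗∼∧ , ∼.trans (≈⇒∼ (¬-⊗ x y)) ⊗∼∧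
    ; ⊕-homo = λ x y → ⊕∼∨ , ∼.trans (≈⇒∼ (¬-⊕ x y)) ⊕∼∨
    ; ⊃-homo = λ x y → ∼.refl , ¬-⊃
    ; ¬-homo = λ x → ∼.refl , ≈⇒∼ (¬-involutive x)
    }

-- Residuation in a classical implicative lattice.

module ClassicalImplicativeLatticeProperties (L : ClassicalImplicativeLattice c ℓ) where

  open ClassicalImplicativeLattice L
  private
    algLattice : Lattice c ℓ
    algLattice = record { isLattice = isLattice }
    module ≤ = Order.Lattice (LatticeProperties.∨-∧-orderTheoreticLattice algLattice)
    module Complement x y = IsRelativeComplement (∖-complement x y)
  open MeetProperties ≤.meetSemilattice using (∧-monotonic)
  open JoinProperties ≤.joinSemilattice using (x≤y⇒x∨y≈y)
  open PartialOrderReasoning ≤.poset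

  -- z = z ⊓ (x ⊔ (x ∖ y)) = (z ⊓ x) ⊔ (z ⊓ (x ∖ y)), and x ∖ y is above z ⊓ x
  -- as soon as z ⊓ x ≤ y, since x ⊓ y ≤ x ∖ y.
  ∖-transpose : ∀ {x y z} → z ⊓ x ≤ y → z ≤ x ∖ y
  ∖-transpose {x} {y} {z} z⊓x≤y = begin
    z                          ≤⟨ ≤.∧-greatest ≤.refl (maximum z) ⟩
    z ⊓ 𝟏                      ≈⟨ ∧-congˡ (Complement.join x y) ⟨
    z ⊓ (x ⊔ (x ∖ y))          ≈⟨ ∧-distribˡ-∨ z x (x ∖ y) ⟩
    (z ⊓ x) ⊔ (z ⊓ (x ∖ y))    ≤⟨ ≤.∨-least z⊓x≤x∖y (≤.x∧y≤y _ _) ⟩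
    x ∖ y                      ∎
    where
    z⊓x≤x∖y : z ⊓ x ≤ x ∖ y
    z⊓x≤x∖y = begin
      z ⊓ x          ≤⟨ ≤.∧-greatest (≤.x∧y≤y z x) z⊓x≤y ⟩
      x ⊓ y          ≈⟨ Complement.meet x y ⟨
      x ⊓ (x ∖ y)    ≤⟨ ≤.x∧y≤y _ _ ⟩
      x ∖ y          ∎

  ∖-untranspose : ∀ {x y z} → z ≤ x ∖ y → z ⊓ x ≤ y
  ∖-untranspose {x} {y} {z} z≤x∖y = begin
    z ⊓ x          ≤⟨ ∧-monotonic z≤x∖y ≤.refl ⟩
    (x ∖ y) ⊓ x    ≈⟨ ∧-comm _ _ ⟩
    x ⊓ (x ∖ y)    ≈⟨ Complement.meet x y ⟩
    x ⊓ y          ≤⟨ ≤.x∧y≤y x y ⟩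
    y              ∎

  ∖-identity : ∀ x y → ((x ∖ x) ∖ y) ≈ y
  ∖-identity x y = ≤.antisym
    (≤.trans (≤.∧-greatest ≤.refl (∖-transpose (≤.x∧y≤y _ _))) (∖-untranspose ≤.refl))
    (∖-transpose (≤.x∧y≤x _ _))

  ∖-top : ∀ x y → ((x ∖ x) ⊓ y) ≈ y
  ∖-top x y = ≤.antisym (≤.x∧y≤y _ _) (≤.∧-greatest (∖-transpose (≤.x∧y≤y _ _)) ≤.refl)

  -- By residuation, an element `w` is below either side exactly when `w ⊓ x ⊓ y` is below `z`; only
  -- associativity intervenes.
  ∖-curry : ∀ x y z → (x ∖ (y ∖ z)) ≈ ((x ⊓ y) ∖ z)
  ∖-curry x y z = ≤.antisym
    (∖-transpose (≤.trans (≤.reflexive (sym (∧-assoc _ _ _)))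
      (∖-untranspose (∖-untranspose ≤.refl))))
    (∖-transpose (∖-transpose (≤.trans (≤.reflexive (∧-assoc _ _ _))
      (∖-untranspose ≤.refl))))

  -- A case split along `Complement.join`: the part of `p` inside `x` is trivially below `x`, and
  -- the part inside the relative complement is so by residuation.
  ∖-peirce : ∀ x y → ((x ∖ y) ∖ x) ≈ x
  ∖-peirce x y = ≤.antisym
    (begin
      p                          ≤⟨ ≤.∧-greatest ≤.refl (maximum p) ⟩
      p ⊓ 𝟏                      ≈⟨ ∧-congˡ (Complement.join x y) ⟨
      p ⊓ (x ⊔ (x ∖ y))          ≈⟨ ∧-distribˡ-∨ p x (x ∖ y) ⟩
      (p ⊓ x) ⊔ (p ⊓ (x ∖ y))    ≤⟨ ≤.∨-least (≤.x∧y≤y _ _) (∖-untranspose ≤.refl) ⟩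
      x                          ∎)
    (∖-transpose (≤.x∧y≤x _ _))
    where p = (x ∖ y) ∖ x

  ∖-distribʳ-⊔ : ∀ x y z → ((x ⊔ y) ∖ z) ≈ ((x ∖ z) ⊓ (y ∖ z))
  ∖-distribʳ-⊔ x y z = ≤.antisym
    (≤.∧-greatest
      (∖-transpose (≤.trans (∧-monotonic ≤.refl (≤.x≤x∨y x y)) (∖-untranspose ≤.refl)))
      (∖-transpose (≤.trans (∧-monotonic ≤.refl (≤.y≤x∨y x y)) (∖-untranspose ≤.refl))))
    (∖-transpose (≤.trans (≤.reflexive (∧-distribˡ-∨ _ x y))
      (≤.∨-least (∖-untranspose (≤.x∧y≤x _ _)) (∖-untranspose (≤.x∧y≤y _ _)))))

  -- Transposing leaves the meet condition that defines the relative complement. This is the first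
  -- coordinate of `IB5`; `⊔-absorb` is the second.
  ⊓-∖-∖ : ∀ x y → (x ⊓ ((x ∖ y) ∖ (x ⊓ y))) ≈ x
  ⊓-∖-∖ x y = sym (∖-transpose (≤.reflexive (Complement.meet x y)))

  ⊔-absorb : ∀ x y z → (x ⊔ (z ⊓ (x ⊓ y))) ≈ x
  ⊔-absorb x y z = ≤.antisym
    (≤.∨-least ≤.refl (≤.trans (≤.x∧y≤y _ _) (≤.x∧y≤x _ _)))
    (≤.x≤x∨y _ _)

  -- On pairs, `≤ₜ` uses `⊓` in the first coordinate and `⊔` in the second. As `¬` swaps them, its
  -- antitonicity needs translations between the two forms of the order.
  ≤⇒⊔ : ∀ {x y} → x ≤ y → y ≈ (y ⊔ x)
  ≤⇒⊔ {x} {y} x≤y = trans (sym (x≤y⇒x∨y≈y x≤y)) (∨-comm x y)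

  ⊔⇒≤ : ∀ {x y} → y ≈ (y ⊔ x) → x ≤ y
  ⊔⇒≤ y≈y⊔x = ≤.trans (≤.y≤x∨y _ _) (≤.reflexive (sym y≈y⊔x))

  -- The implicative bilattice axioms in the product.

  ⊙²-isBilattice : IsBilatticeReduct (L ⊙²)
  ⊙²-isBilattice = record
    { ∧-∨-isLattice = record
      { isEquivalence = ⊙².isEquivalence
      ; ∨-comm     = λ _ _ → ∨-comm _ _ , ∧-comm _ _
      ; ∨-assoc    = λ _ _ _ → ∨-assoc _ _ _ , ∧-assoc _ _ _
      ; ∨-cong     = ⊙².∨-cong
      ; ∧-comm     = λ _ _ → ∧-comm _ _ , ∨-comm _ _
      ; ∧-assoc    = λ _ _ _ → ∧-assoc _ _ _ , ∨-assoc _ _ _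
      ; ∧-cong     = ⊙².∧-cong
      ; absorptive = (λ _ _ → ∨-absorbs-∧ _ _ , ∧-absorbs-∨ _ _)
                   , (λ _ _ → ∧-absorbs-∨ _ _ , ∨-absorbs-∧ _ _)
      }
    ; ⊗-⊕-isLattice = record
      { isEquivalence = ⊙².isEquivalence
      ; ∨-comm     = λ _ _ → ∨-comm _ _ , ∨-comm _ _
      ; ∨-assoc    = λ _ _ _ → ∨-assoc _ _ _ , ∨-assoc _ _ _
      ; ∨-cong     = ⊙².⊕-cong
      ; ∧-comm     = λ _ _ → ∧-comm _ _ , ∧-comm _ _
      ; ∧-assoc    = λ _ _ _ → ∧-assoc _ _ _ , ∧-assoc _ _ _
      ; ∧-cong     = ⊙².⊗-cong
      ; absorptive = (λ _ _ → ∨-absorbs-∧ _ _ , ∨-absorbs-∧ _ _)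
                   , (λ _ _ → ∧-absorbs-∨ _ _ , ∧-absorbs-∨ _ _)
      }
    ; ¬-antitoneₜ  = λ (x₁≤y₁ , y₂≤x₂) → ⊔⇒≤ y₂≤x₂ , ≤⇒⊔ x₁≤y₁
    ; ¬-monotoneₖ  = λ (x₁≤y₁ , x₂≤y₂) → x₂≤y₂ , x₁≤y₁
    ; ¬-involutive = λ _ → refl , refl
    }
    where
    module ⊙² = BilatticeAlgebra (L ⊙²)

  ⊙²-isImplicativeBilattice : IsImplicativeBilattice (L ⊙²)
  ⊙²-isImplicativeBilattice = record
    { isBilattice = ⊙²-isBilattice
    ; IB1  = λ _ _ → ∖-identity _ _ , ∖-top _ _
    ; IB2ₜ = λ _ _ _ → ∖-curry _ _ _ , sym (∧-assoc _ _ _)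
    ; IB2ₖ = λ _ _ _ → refl , refl
    ; IB3  = λ _ _ → ∖-cong (∖-peirce _ _) refl , ∧-congʳ (∖-peirce _ _)
    ; IB4ₜ = λ _ _ _ → ∖-distribʳ-⊔ _ _ _ , ∧-distribʳ-∨ _ _ _
    ; IB4ₖ = λ _ _ _ → sym (∖-distribʳ-⊔ _ _ _) , sym (∧-distribʳ-∨ _ _ _)
    ; IB5  = λ _ _ → ⊓-∖-∖ _ _ , ⊔-absorb _ _ _
    ; IB6  = λ _ _ _ → refl , refl
    }

-- Transport of the axioms along an isomorphism.

module Transport {A B : BilatticeAlgebra c ℓ}
                 {f : BilatticeAlgebra.Carrier A → BilatticeAlgebra.Carrier B}
                 (isIsomorphism : IsIsomorphism A B f) where

  open IsIsomorphism isIsomorphism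
  open IsRelIsomorphism isRelIsomorphism using (cong; injective; isHomomorphism)
  private
    module A = BilatticeAlgebra A
    module B = BilatticeAlgebra B
  open A using (_∧_; _∨_; _⊗_; _⊕_; _⊃_; ¬_)
  open IsEquivalence B.isEquivalence

  ∧-∨-isLatticeMonomorphism : IsLatticeMonomorphism
    (record { _≈_ = A._≈_ ; _∧_ = A._∧_ ; _∨_ = A._∨_ })
    (record { _≈_ = B._≈_ ; _∧_ = B._∧_ ; _∨_ = B._∨_ }) f
  ∧-∨-isLatticeMonomorphism = record
    { isLatticeHomomorphism = record
      { isRelHomomorphism = isHomomorphism ; ∧-homo = ∧-homo ; ∨-homo = ∨-homo }
    ; injective = injective
    }

  ⊗-⊕-isLatticeMonomorphism : IsLatticeMonomorphism
    (record { _≈_ = A._≈_ ; _∧_ = A._⊗_ ; _∨_ = A._⊕_ })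
    (record { _≈_ = B._≈_ ; _∧_ = B._⊗_ ; _∨_ = B._⊕_ }) f
  ⊗-⊕-isLatticeMonomorphism = record
    { isLatticeHomomorphism = record
      { isRelHomomorphism = isHomomorphism ; ∧-homo = ⊗-homo ; ∨-homo = ⊕-homo }
    ; injective = injective
    }

  infix 4 _↦_

  -- Relates a compound element of `A` to the same term evaluated in `B`; derivations follow the
  -- shape of the term, so an identity is transferred by evaluating its two sides.
  _↦_ : A.Carrier → B.Carrier → Set _
  x ↦ y = f x B.≈ y

  var : ∀ x → x ↦ f x
  var x = refl

  module _ {x y : A.Carrier} {x′ y′ : B.Carrier} (p : x ↦ x′) (q : y ↦ y′) where

    ∧-↦ : x ∧ y ↦ x′ B.∧ y′
    ∧-↦ = trans (∧-homo x y) (B.∧-cong p q)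

    ∨-↦ : x ∨ y ↦ x′ B.∨ y′
    ∨-↦ = trans (∨-homo x y) (B.∨-cong p q)

    ⊗-↦ : x ⊗ y ↦ x′ B.⊗ y′
    ⊗-↦ = trans (⊗-homo x y) (B.⊗-cong p q)

    ⊕-↦ : x ⊕ y ↦ x′ B.⊕ y′
    ⊕-↦ = trans (⊕-homo x y) (B.⊕-cong p q)

    ⊃-↦ : x ⊃ y ↦ x′ B.⊃ y′
    ⊃-↦ = trans (⊃-homo x y) (B.⊃-cong p q)

  ¬-↦ : ∀ {x x′} → x ↦ x′ → ¬ x ↦ B.¬ x′
  ¬-↦ p = trans (¬-homo _) (B.¬-cong p)

  pull : ∀ {x y x′ y′} → x ↦ x′ → y ↦ y′ → x′ B.≈ y′ → x A.≈ y
  pull p q x′≈y′ = injective (trans p (trans x′≈y′ (sym q)))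

  -- Carries the order hypotheses of the two monotonicity conditions on `¬` into `B`.
  push : ∀ {x y x′ y′} → x ↦ x′ → y ↦ y′ → x A.≈ y → x′ B.≈ y′
  push p q x≈y = trans (sym p) (trans (cong x≈y) q)

  isImplicativeBilattice : IsImplicativeBilattice B → IsImplicativeBilattice A
  isImplicativeBilattice I = record
    { isBilattice = record
      { ∧-∨-isLattice = LatticeMonomorphism.isLattice ∧-∨-isLatticeMonomorphism ∧-∨-isLattice
      ; ⊗-⊕-isLattice = LatticeMonomorphism.isLattice ⊗-⊕-isLatticeMonomorphism ⊗-⊕-isLattice
      ; ¬-antitoneₜ   = λ {x} {y} x≤y →
          pull (¬-↦ (var y)) (∧-↦ (¬-↦ (var y)) (¬-↦ (var x)))
            (¬-antitoneₜ (push (var x) (∧-↦ (var x) (var y)) x≤y))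
      ; ¬-monotoneₖ   = λ {x} {y} x≤y →
          pull (¬-↦ (var x)) (⊗-↦ (¬-↦ (var x)) (¬-↦ (var y)))
            (¬-monotoneₖ (push (var x) (⊗-↦ (var x) (var y)) x≤y))
      ; ¬-involutive  = λ x → pull (¬-↦ (¬-↦ (var x))) (var x) (¬-involutive (f x))
      }
    ; IB1  = λ x y → let x′ = var x; y′ = var y in
        pull (⊃-↦ (⊃-↦ x′ x′) y′) y′ (IB1 _ _)
    ; IB2ₜ = λ x y z → let x′ = var x; y′ = var y; z′ = var z in
        pull (⊃-↦ x′ (⊃-↦ y′ z′)) (⊃-↦ (∧-↦ x′ y′) z′) (IB2ₜ _ _ _)
    ; IB2ₖ = λ x y z → let x′ = var x; y′ = var y; z′ = var z in
        pull (⊃-↦ (∧-↦ x′ y′) z′) (⊃-↦ (⊗-↦ x′ y′) z′) (IB2ₖ _ _ _)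
    ; IB3  = λ x y → let x′ = var x; y′ = var y in
        pull (⊃-↦ (⊃-↦ (⊃-↦ x′ y′) x′) x′) (⊃-↦ x′ x′) (IB3 _ _)
    ; IB4ₜ = λ x y z → let x′ = var x; y′ = var y; z′ = var z in
        pull (⊃-↦ (∨-↦ x′ y′) z′) (∧-↦ (⊃-↦ x′ z′) (⊃-↦ y′ z′)) (IB4ₜ _ _ _)
    ; IB4ₖ = λ x y z → let x′ = var x; y′ = var y; z′ = var z in
        pull (∧-↦ (⊃-↦ x′ z′) (⊃-↦ y′ z′)) (⊃-↦ (⊕-↦ x′ y′) z′) (IB4ₖ _ _ _)
    ; IB5  = λ x y → let x′ = var x; y′ = var y in
        pull (∧-↦ x′ (⊃-↦ (⊃-↦ x′ y′) (⊗-↦ x′ y′))) x′ (IB5 _ _)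
    ; IB6  = λ x y z → let x′ = var x; y′ = var y; z′ = var z in
        pull (⊃-↦ (¬-↦ (⊃-↦ x′ y′)) z′) (⊃-↦ (∧-↦ x′ (¬-↦ y′)) z′) (IB6 _ _ _)
    }
    where
    open IsImplicativeBilattice I
    open IsBilattice isBilattice

theorem5p1p5 : {c ℓ : Level} (B : BilatticeAlgebra c ℓ) →
    IsImplicativeBilattice B ⇔ ∃ (λ (L : ClassicalImplicativeLattice c ℓ) → B ≅ L ⊙²)
theorem5p1p5 B = mk⇔
  (λ I → Entailment.quotient B I , Entailment.to B I , Entailment.to-isIsomorphism B I)
  (λ (L , _ , isIsomorphism) → Transport.isImplicativeBilattice isIsomorphism
    (ClassicalImplicativeLatticeProperties.⊙²-isImplicativeBilattice L))
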